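{- For every integer $\Delta\ge4$, there is a connected graph $G$ with maximum degree exactly $\Delta$ such that \[ \tau_D(G)>\frac{\Delta(\Delta-1)n+2m}{\Delta^2+1}, \] where $n=|V(G)|$ and $m=|E(G)|$.
   Context: All graphs are finite, simple and undirected. A set $T\subseteq V(G)$ is an identifying vertex cover if $e\cap T\neq\emptyset$ for every $e\in E(G)$ and the sets $e\cap T$ ($e\in E(G)$) are pairwise distinct; $\tau_D(G)$ is the minimum cardinality of an identifying vertex cover of $G$. -}

module Defs where

open import Data.Bool.Properties using () renaming (_≟_ to _≟ᵇ_)
open import Data.Fin using (Fin; _<_)
open import Data.Fin.Properties using (_<?_; any?)
open import Data.Fin.Subset using (Subset; _∩_; _∪_; ⁅_⁆; ∣_∣; ⊤; Nonempty)
open import Data.Fin.Subset.Properties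
  using (anySubset?; nonempty?; ∩-identityʳ; x∈⁅x⁆; x∈p∪q⁺)
open import Data.List using (List; length; filter; allFin; cartesianProduct)
open import Data.Nat using (ℕ; zero; suc; _≤_; z≤n; s≤s) renaming (_≟_ to _≟ⁿ_)
open import Data.Product using (∃; ∃-syntax; _×_; _,_; proj₁; proj₂)
open import Data.Sum using (inj₁)
open import Data.Vec.Properties using (≡-dec)
open import Level using (0ℓ)
open import Relation.Binary.Construct.Closure.ReflexiveTransitive using (Star)
open import Relation.Binary.Core using (Rel)
open import Relation.Binary.Definitions
  using (Symmetric; Irreflexive; DecidableEquality) renaming (Decidable to Decidable₂)
open import Relation.Binary.PropositionalEquality using (_≡_; refl; sym; trans; subst)
open import Relation.Nullary using (Dec; yes; no; ¬_; ¬?; contradiction)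
open import Relation.Nullary.Decidable using (map′; decidable-stable; _×-dec_; _→-dec_)
open import Relation.Unary using (Pred; Decidable)

-- The vertex set is Fin order.
record Graph : Set₁ where
  infix 4 _~_ _~?_
  field
    order    : ℕ
    _~_      : Rel (Fin order) 0ℓ
    _~?_     : Decidable₂ _~_
    ~-sym    : Symmetric _~_
    ~-irrefl : Irreflexive _≡_ _~_

module _ (G : Graph) where
  open Graph G

  V : Set
  V = Fin order

  -- An edge is the two-element vertex set {u , v} itself, so it carries no
  -- orientation and _≡_ on subsets is equality of edges.
  IsEdge : Pred (Subset order) 0ℓ
  IsEdge e = ∃[ u ] ∃[ v ] u ~ v × e ≡ ⁅ u ⁆ ∪ ⁅ v ⁆

  -- Each edge is listed once, by its ordered pair of endpoints.
  edges : List (V × V)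
  edges = filter (λ (u , v) → (u <? v) ×-dec (u ~? v))
                 (cartesianProduct (allFin order) (allFin order))

  size : ℕ
  size = length edges

  degree : V → ℕ
  degree v = length (filter (v ~?_) (allFin order))

  HasMaxDegree : ℕ → Set
  HasMaxDegree Δ = (∀ v → degree v ≤ Δ) × (∃[ v ] degree v ≡ Δ)

  -- Nonempty, and any two vertices are joined by a walk.
  Connected : Set
  Connected = V × (∀ (u v : V) → Star _~_ u v)

  IsIdentifyingVertexCover : Pred (Subset order) 0ℓ
  IsIdentifyingVertexCover T =
    (∀ e → IsEdge e → Nonempty (e ∩ T)) ×
    (∀ e f → IsEdge e → IsEdge f → e ∩ T ≡ f ∩ T → e ≡ f)

  IsMinIVCSize : Pred ℕ 0ℓ
  IsMinIVCSize k =
    (∃[ T ] IsIdentifyingVertexCover T × ∣ T ∣ ≡ k) ×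
    (∀ T → IsIdentifyingVertexCover T → k ≤ ∣ T ∣)

private
  least : {P : Pred ℕ 0ℓ} → Decidable P → ∀ n → P n →
          ∃[ k ] P k × (∀ m → P m → k ≤ m)
  least P? n pn with P? 0
  ... | yes p0 = 0 , p0 , λ _ _ → z≤n
  least P? zero    pn | no ¬p0 = contradiction pn ¬p0
  least {P} P? (suc n) pn | no ¬p0
    with k , pk , k-min ← least {λ i → P (suc i)} (λ i → P? (suc i)) n pn
    = suc k , pk , λ where
        zero    p0 → contradiction p0 ¬p0
        (suc m) pm → s≤s (k-min m pm)

  allSubset? : ∀ {n} {P : Pred (Subset n) 0ℓ} → Decidable P → Dec (∀ p → P p)
  allSubset? P? = map′
    (λ ∄ p → decidable-stable (P? p) (λ ¬Pp → ∄ (p , ¬Pp)))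
    (λ ∀P (p , ¬Pp) → ¬Pp (∀P p))
    (¬? (anySubset? (λ p → ¬? (P? p))))

  _≟ˢ_ : ∀ {n} → DecidableEquality (Subset n)
  _≟ˢ_ = ≡-dec _≟ᵇ_

module _ (G : Graph) where
  open Graph G

  isEdge? : Decidable (IsEdge G)
  isEdge? e = any? λ u → any? λ v → (u ~? v) ×-dec (e ≟ˢ (⁅ u ⁆ ∪ ⁅ v ⁆))

  isIdentifyingVertexCover? : Decidable (IsIdentifyingVertexCover G)
  isIdentifyingVertexCover? T =
    allSubset? (λ e → isEdge? e →-dec nonempty? (e ∩ T)) ×-dec
    allSubset? (λ e → allSubset? (λ f →
      isEdge? e →-dec (isEdge? f →-dec (((e ∩ T) ≟ˢ (f ∩ T)) →-dec (e ≟ˢ f)))))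

  ⊤-isIdentifyingVertexCover : IsIdentifyingVertexCover G ⊤
  ⊤-isIdentifyingVertexCover =
    (λ { e (u , v , _ , refl) → subst Nonempty (sym (∩-identityʳ e))
                                  (u , x∈p∪q⁺ (inj₁ (x∈⁅x⁆ u))) }) ,
    (λ e f _ _ eq → trans (sym (∩-identityʳ e)) (trans eq (∩-identityʳ f)))

  minIVCSize : ∃ (IsMinIVCSize G)
  minIVCSize
    with k , k-attained , k-min ← least
      (λ k → anySubset? (λ T → isIdentifyingVertexCover? T ×-dec (∣ T ∣ ≟ⁿ k)))
      ∣ ⊤ {order} ∣ (⊤ , ⊤-isIdentifyingVertexCover , refl)
    = k , k-attained , λ T ivc → k-min ∣ T ∣ (T , ivc , refl)

  τD : ℕ
  τD = proj₁ minIVCSize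

  τD-isMin : IsMinIVCSize G τD
  τD-isMin = proj₂ minIVCSize

{-# OPTIONS --safe #-}

-- The complement of an identifying vertex cover consists of vertices at pairwise
-- distance at least 3, so τD G ≥ n - 1 whenever G has diameter at most 2.  The
-- Petersen graph attains equality in the claimed inequality for Δ = 3.  Adding t
-- twins of one of its vertices keeps the diameter at 2 and gives Δ = 3 + t,
-- n = 10 + t, m = 15 + 3t, for which (n - 1)(Δ² + 1) exceeds Δ(Δ - 1)n + 2m by 2t.
module Submission where

open import Defs
open import Data.Fin using (Fin; zero; suc; _<_; _↑ʳ_; #_)
open import Data.Fin.Properties using (_<?_; all?; any?)
open import Data.Fin.Subset
  using (Subset; _∈_; _∉_; _⊆_; _∩_; _∪_; ⁅_⁆; ∣_∣; ∁; Empty)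
open import Data.Fin.Subset.Properties
open import Data.Integer using (+_)
import Data.Integer as ℤ
import Data.Integer.Properties as ℤ
open import Data.List
  using (List; []; _∷_; _++_; length; filter; map; allFin; tabulate; cartesianProduct)
open import Data.List.Properties using (filter-++; filter-reject; length-++; map-tabulate; map-∘)
open import Data.Nat using (ℕ; zero; suc; z≤n; s≤s; _+_; _*_; _∸_; _^_; _≤_)
import Data.Nat as ℕ
import Data.Nat.Properties as ℕ
open import Data.Nat.Tactic.RingSolver using (solve-∀)
open import Data.Product using (∃-syntax; _×_; _,_; proj₁; proj₂)
open import Data.Rational using (_/_; _>_; fromℚᵘ)
import Data.Rational as ℚ
import Data.Rational.Properties as ℚ
open import Data.Rational.Unnormalised using (mkℚᵘ; *<*)
import Data.Rational.Unnormalised as ℚᵘ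
import Data.Rational.Unnormalised.Properties as ℚᵘ
open import Data.Sum using (_⊎_; inj₁; inj₂; [_,_]′)
open import Data.Vec using (Vec; []; _∷_; lookup)
open import Function using (_∘_; id)
open import Level using (Level)
open import Relation.Binary.Construct.Closure.ReflexiveTransitive using (Star; ε; _◅_)
open import Relation.Binary.PropositionalEquality
open import Relation.Nullary using (Dec; yes; no; ¬_; ¬?; contradiction)
open import Relation.Nullary.Decidable using (from-yes; _×-dec_; _⊎-dec_)
open import Relation.Unary using (Pred; Decidable)

private variable
  a p q : Level
  A B : Set a

-- Counting in filtered lists

length-filter-++ : {P : Pred A p} (P? : Decidable P) (xs ys : List A) →
  length (filter P? (xs ++ ys)) ≡ length (filter P? xs) + length (filter P? ys)
length-filter-++ P? xs ys =
  trans (cong length (filter-++ P? xs ys)) (length-++ (filter P? xs))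

length-filter-map : {P : Pred B p} {Q : Pred A q} (P? : Decidable P) (Q? : Decidable Q)
  (f : A → B) → (∀ x → P (f x) → Q x) → (∀ x → Q x → P (f x)) →
  ∀ xs → length (filter P? (map f xs)) ≡ length (filter Q? xs)
length-filter-map P? Q? f to from []       = refl
length-filter-map P? Q? f to from (x ∷ xs) with P? (f x) | Q? x
... | yes _ | yes _ = cong suc (length-filter-map P? Q? f to from xs)
... | no _  | no _  = length-filter-map P? Q? f to from xs
... | yes r | no ¬s = contradiction (to x r) ¬s
... | no ¬r | yes s = contradiction (from x s) ¬r

-- This serves the count of edges that avoid vertex `zero`. Edges are listed with the smaller
-- endpoint first, so the column `(suc i , zero)` contributes nothing and the rest is a shifted copy
-- of the smaller grid.
length-filter-cartesianProduct-suc : ∀ {n}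
  {P : Pred (Fin (suc n) × Fin (suc n)) p} {Q : Pred (Fin n × Fin n) q}
  (P? : Decidable P) (Q? : Decidable Q) →
  (∀ i → ¬ P (suc i , zero)) →
  (∀ i j → P (suc i , suc j) → Q (i , j)) → (∀ i j → Q (i , j) → P (suc i , suc j)) →
  ∀ is js → length (filter P? (cartesianProduct (map suc is) (zero ∷ map suc js))) ≡
            length (filter Q? (cartesianProduct is js))
length-filter-cartesianProduct-suc P? Q? ¬P to from []       js = refl
length-filter-cartesianProduct-suc P? Q? ¬P to from (i ∷ is) js = begin
  length (filter P? ((suc i , zero) ∷ row⁺ ++ rows⁺))
    ≡⟨ cong length (filter-reject P? (¬P i)) ⟩
  length (filter P? (row⁺ ++ rows⁺))
    ≡⟨ length-filter-++ P? row⁺ rows⁺ ⟩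
  length (filter P? row⁺) + length (filter P? rows⁺)
    ≡⟨ cong₂ _+_
         -- Both lists are `map (λ j → suc i , suc j) js`, read first as a shift of second
         -- coordinates, then as a shift of whole pairs.
         (trans (cong (length ∘ filter P?) (trans (sym (map-∘ js)) (map-∘ js)))
           (length-filter-map P? Q? (λ (k , j) → suc k , suc j)
             (λ (k , j) → to k j) (λ (k , j) → from k j) (map (i ,_) js)))
         (length-filter-cartesianProduct-suc P? Q? ¬P to from is js) ⟩
  length (filter Q? (map (i ,_) js)) + length (filter Q? (cartesianProduct is js))
    ≡⟨ length-filter-++ Q? (map (i ,_) js) _ ⟨
  length (filter Q? (map (i ,_) js ++ cartesianProduct is js)) ∎
  where
  open ≡-Reasoning
  row⁺ = map (suc i ,_) (map suc js)
  rows⁺ = cartesianProduct (map suc is) (zero ∷ map suc js)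

allFin-suc : ∀ n → allFin (suc n) ≡ zero ∷ map suc (allFin n)
allFin-suc n = cong (zero ∷_) (sym (map-tabulate id suc))

-- Comparing fractions by cross-multiplication

fromℚᵘ-mono-< : ∀ {p q} → p ℚᵘ.< q → fromℚᵘ p ℚ.< fromℚᵘ q
fromℚᵘ-mono-< {p} {q} p<q = ℚ.toℚᵘ-cancel-<
  (ℚᵘ.<-respˡ-≃ (ℚᵘ.≃-sym (ℚ.toℚᵘ-fromℚᵘ p))
    (ℚᵘ.<-respʳ-≃ (ℚᵘ.≃-sym (ℚ.toℚᵘ-fromℚᵘ q)) p<q))

-- Going through unnormalised fractions keeps the reduction to lowest terms out of the comparison.
/<-from-*< : ∀ k m d → k ℕ.< m * suc d → + k / suc d ℚ.< + m / 1
/<-from-*< k m d k<md = fromℚᵘ-mono-< {mkℚᵘ (+ k) d} {mkℚᵘ (+ m) 0} (*<* (subst₂ ℤ._<_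
  (sym (ℤ.*-identityʳ (+ k))) (ℤ.pos-* m (suc d)) (ℤ.+<+ k<md)))

-- Identifying vertex covers in diameter at most 2

∣p∣≤1 : ∀ {n} (p : Subset n) → (∀ {x y} → x ∈ p → y ∈ p → x ≡ y) → ∣ p ∣ ≤ 1
∣p∣≤1 {n} p unique with nonempty? p
... | yes (x , x∈p) = subst (∣ p ∣ ≤_) (∣⁅x⁆∣≡1 x)
        (p⊆q⇒∣p∣≤∣q∣ λ y∈p → subst (_∈ ⁅ x ⁆) (unique x∈p y∈p) (x∈⁅x⁆ x))
... | no empty      = subst (_≤ 1)
        (sym (trans (cong ∣_∣ (Empty-unique empty)) (∣⊥∣≡0 n))) z≤n

module _ (G : Graph) where
  open Graph G

  -- The case `u ≡ v` is included and amounts to `u` having a neighbour. This is what later places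
  -- two twins at distance 2.
  DiameterAtMost2 : Set
  DiameterAtMost2 = ∀ u v → u ~ v ⊎ ∃[ w ] u ~ w × w ~ v

  module _ (near : DiameterAtMost2) where

    diameter≤2⇒walk : ∀ u v → Star _~_ u v
    diameter≤2⇒walk u v with near u v
    ... | inj₁ u~v             = u~v ◅ ε
    ... | inj₂ (_ , u~w , w~v) = u~w ◅ w~v ◅ ε

    module _ {T : Subset order} (ivc : IsIdentifyingVertexCover G T) where

      trace-⊆ : ∀ {u v w} → u ∉ T → (⁅ u ⁆ ∪ ⁅ w ⁆) ∩ T ⊆ (⁅ v ⁆ ∪ ⁅ w ⁆) ∩ T
      trace-⊆ {u} {v} {w} u∉T x∈ with x∈p∩q⁻ _ _ x∈
      ... | x∈e , x∈T with x∈p∪q⁻ ⁅ u ⁆ ⁅ w ⁆ x∈e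
      ...   | inj₁ x∈u = contradiction (subst (_∈ T) (x∈⁅y⁆⇒x≡y u x∈u) x∈T) u∉T
      ...   | inj₂ x∈w = x∈p∩q⁺ (x∈p∪q⁺ (inj₂ x∈w) , x∈T)

      -- If `u` and `v` were adjacent, their edge would miss `T`. If they share a neighbour `w`, the
      -- edges `uw` and `vw` have the same trace on `T`, since only `w` can lie in it, so they are
      -- the same edge.
      uncovered-unique : ∀ {u v} → u ∉ T → v ∉ T → u ≡ v
      uncovered-unique {u} {v} u∉T v∉T with near u v
      ... | inj₁ u~v =
        let x , x∈ = proj₁ ivc _ (u , v , u~v , refl)
            x∈e , x∈T = x∈p∩q⁻ _ _ x∈
        in [ (λ x∈u → contradiction (subst (_∈ T) (x∈⁅y⁆⇒x≡y u x∈u) x∈T) u∉T)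
           , (λ x∈v → contradiction (subst (_∈ T) (x∈⁅y⁆⇒x≡y v x∈v) x∈T) v∉T)
           ]′ (x∈p∪q⁻ ⁅ u ⁆ ⁅ v ⁆ x∈e)
      ... | inj₂ (w , u~w , w~v) =
        let e≡f = proj₂ ivc _ _ (u , w , u~w , refl) (v , w , ~-sym w~v , refl)
                    (⊆-antisym (trace-⊆ u∉T) (trace-⊆ v∉T))
            u∈f = subst (u ∈_) e≡f (x∈p∪q⁺ (inj₁ (x∈⁅x⁆ u)))
        in [ x∈⁅y⁆⇒x≡y v
           , (λ u∈w → contradiction u~w (~-irrefl (x∈⁅y⁆⇒x≡y w u∈w)))
           ]′ (x∈p∪q⁻ ⁅ v ⁆ ⁅ w ⁆ u∈f)

      order≤1+∣T∣ : order ≤ 1 + ∣ T ∣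
      order≤1+∣T∣ = begin
        order                     ≤⟨ ℕ.m≤n+m∸n order ∣ T ∣ ⟩
        ∣ T ∣ + (order ∸ ∣ T ∣)   ≡⟨ cong (∣ T ∣ ℕ.+_) (sym (∣∁p∣≡n∸∣p∣ T)) ⟩
        ∣ T ∣ + ∣ ∁ T ∣           ≤⟨ ℕ.+-monoʳ-≤ ∣ T ∣ (∣p∣≤1 (∁ T) λ u∈ v∈ →
                                       uncovered-unique (x∈∁p⇒x∉p u∈) (x∈∁p⇒x∉p v∈)) ⟩
        ∣ T ∣ + 1                 ≡⟨ ℕ.+-comm ∣ T ∣ 1 ⟩
        1 + ∣ T ∣                 ∎
        where open ℕ.≤-Reasoning

    order≤1+minIVCSize : ∀ {k} → IsMinIVCSize G k → order ≤ 1 + k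
    order≤1+minIVCSize ((_ , ivc , refl) , _) = order≤1+∣T∣ ivc

-- Adding twins of a vertex

module Twins (H : Graph) (z : V H) where
  open Graph H

  -- The added twins of z come first in the numbering of the vertices.
  original : ∀ t → Fin (t + order) → V H
  original zero    v       = v
  original (suc t) zero    = z
  original (suc t) (suc v) = original t v

  original-↑ʳ : ∀ t v → original t (t ↑ʳ v) ≡ v
  original-↑ʳ zero    v = refl
  original-↑ʳ (suc t) v = original-↑ʳ t v

  -- Adjacency is pulled back along `original`, so the copies of `z` are pairwise non-adjacent and
  -- share their neighbours.
  withTwins : ℕ → Graph
  withTwins t = record
    { order    = t + order
    ; _~_      = λ u v → original t u ~ original t v
    ; _~?_     = λ u v → original t u ~? original t v
    ; ~-sym    = ~-sym
    ; ~-irrefl = λ { refl → ~-irrefl refl }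
    }

  withTwins-diameter≤2 : DiameterAtMost2 H → ∀ t → DiameterAtMost2 (withTwins t)
  withTwins-diameter≤2 near t u v with near (original t u) (original t v)
  ... | inj₁ u~v             = inj₁ u~v
  ... | inj₂ (w , u~w , w~v) = inj₂ (t ↑ʳ w ,
    subst (λ x → original t u ~ x × x ~ original t v) (sym (original-↑ʳ t w)) (u~w , w~v))

  -- The degree in `withTwins t` of any vertex lying over `v`. Indexing by `v` in `H` fixes it
  -- during induction on `t`.
  neighbours : ∀ t → V H → ℕ
  neighbours t v = length (filter (λ w → v ~? original t w) (allFin (t + order)))

  neighbours-tail : ∀ t v →
    length (filter (λ w → v ~? original (suc t) w) (tabulate suc)) ≡ neighbours t v
  neighbours-tail t v = trans
    (cong (λ ws → length (filter (λ w → v ~? original (suc t) w) ws)) (sym (map-tabulate id suc)))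
    (length-filter-map _ _ suc (λ _ v~w → v~w) (λ _ v~w → v~w) (allFin (t + order)))

  neighbours-~ : ∀ t {v} → v ~ z → neighbours t v ≡ t + degree H v
  neighbours-~ zero        v~z = refl
  neighbours-~ (suc t) {v} v~z with v ~? z
  ... | yes _  = cong suc (trans (neighbours-tail t v) (neighbours-~ t v~z))
  ... | no v≁z = contradiction v~z v≁z

  neighbours-≁ : ∀ t {v} → ¬ v ~ z → neighbours t v ≡ degree H v
  neighbours-≁ zero        v≁z = refl
  neighbours-≁ (suc t) {v} v≁z with v ~? z
  ... | yes v~z = contradiction v~z v≁z
  ... | no _    = trans (neighbours-tail t v) (neighbours-≁ t v≁z)

  -- Only vertices over neighbours of `z` gain degree, exactly `t` each, so the maximum is attained
  -- at the original copy of `v`.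
  withTwins-maxDegree : ∀ {d v} → (∀ u → degree H u ≤ d) → v ~ z → degree H v ≡ d →
    ∀ t → HasMaxDegree (withTwins t) (t + d)
  withTwins-maxDegree {d} {v} degree≤d v~z refl t = degree≤t+d , t ↑ʳ v ,
    trans (cong (neighbours t) (original-↑ʳ t v)) (neighbours-~ t v~z)
    where
    degree≤t+d : ∀ u → neighbours t (original t u) ≤ t + d
    degree≤t+d u with original t u ~? z
    ... | yes u~z = subst (_≤ t + d) (sym (neighbours-~ t u~z)) (ℕ.+-monoʳ-≤ t (degree≤d _))
    ... | no u≁z  = subst (_≤ t + d) (sym (neighbours-≁ t u≁z)) (ℕ.m≤n⇒m≤o+n t (degree≤d _))

  edge? : ∀ t → Decidable (λ ((u , v) : V (withTwins t) × V (withTwins t)) →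
    u < v × original t u ~ original t v)
  edge? t (u , v) = (u <? v) ×-dec (original t u ~? original t v)

  withTwins-size-suc : ∀ t → size (withTwins (suc t)) ≡ neighbours t z + size (withTwins t)
  withTwins-size-suc t = begin
    size (withTwins (suc t))
      -- The newest twin is `zero`, the smaller endpoint of all its edges. The pair `(zero , zero)`
      -- is filtered out by computation.
      ≡⟨ cong (λ us → length (filter E? (cartesianProduct us us))) (allFin-suc (t + order)) ⟩
    length (filter E? (map (zero ,_) (map suc vs) ++ rows))
      ≡⟨ length-filter-++ E? (map (zero ,_) (map suc vs)) rows ⟩
    length (filter E? (map (zero ,_) (map suc vs))) + length (filter E? rows)
      ≡⟨ cong₂ _+_
           (trans (cong (length ∘ filter E?) (sym (map-∘ vs)))
             (length-filter-map E? (λ v → z ~? original t v) (λ v → zero , suc v)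
               (λ _ → proj₂) (λ _ r → s≤s z≤n , r) vs))
           (length-filter-cartesianProduct-suc E? (edge? t) (λ _ ())
             (λ _ _ (u<v , r) → ℕ.s≤s⁻¹ u<v , r) (λ _ _ (u<v , r) → s≤s u<v , r) vs vs) ⟩
    neighbours t z + size (withTwins t) ∎
    where
    open ≡-Reasoning
    E? = edge? (suc t)
    vs = allFin (t + order)
    rows = cartesianProduct (map suc vs) (zero ∷ map suc vs)

  withTwins-size : ∀ t → size (withTwins t) ≡ t * degree H z + size H
  withTwins-size zero    = refl
  withTwins-size (suc t) = begin
    size (withTwins (suc t))                    ≡⟨ withTwins-size-suc t ⟩
    neighbours t z + size (withTwins t)         ≡⟨ cong₂ _+_ (neighbours-≁ t (~-irrefl refl))
                                                             (withTwins-size t) ⟩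
    degree H z + (t * degree H z + size H)      ≡⟨ ℕ.+-assoc (degree H z) _ _ ⟨
    suc t * degree H z + size H                 ∎
    where open ≡-Reasoning

-- The Petersen graph

module Petersen where

  -- The Petersen graph as the Kneser graph KG(5,2).
  label : Vec (Subset 5) 10
  label =
    pair (# 0) (# 1) ∷ pair (# 0) (# 2) ∷ pair (# 0) (# 3) ∷ pair (# 0) (# 4) ∷
    pair (# 1) (# 2) ∷ pair (# 1) (# 3) ∷ pair (# 1) (# 4) ∷
    pair (# 2) (# 3) ∷ pair (# 2) (# 4) ∷ pair (# 3) (# 4) ∷ []
    where
    pair : Fin 5 → Fin 5 → Subset 5
    pair i j = ⁅ i ⁆ ∪ ⁅ j ⁆

  infix 4 _⟷_ _⟷?_

  _⟷_ : Fin 10 → Fin 10 → Set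
  u ⟷ v = Empty (lookup label u ∩ lookup label v)

  _⟷?_ : ∀ u v → Dec (u ⟷ v)
  u ⟷? v = ¬? (nonempty? _)

  ⟷-irrefl : ∀ u → ¬ u ⟷ u
  ⟷-irrefl = from-yes (all? λ u → ¬? (u ⟷? u))

  petersen : Graph
  petersen = record
    { order    = 10
    ; _~_      = _⟷_
    ; _~?_     = _⟷?_
    ; ~-sym    = λ {u} {v} → subst Empty (∩-comm (lookup label u) (lookup label v))
    ; ~-irrefl = λ { {u} refl → ⟷-irrefl u }
    }

  petersen-diameter≤2 : DiameterAtMost2 petersen
  petersen-diameter≤2 = from-yes (all? λ u → all? λ v →
    (u ⟷? v) ⊎-dec any? λ w → (u ⟷? w) ×-dec (w ⟷? v))

  petersen-cubic : ∀ v → degree petersen v ≡ 3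
  petersen-cubic = from-yes (all? λ v → degree petersen v ℕ.≟ 3)

-- Twinned Petersen graphs and the inequality

open Petersen using (petersen; _⟷?_; petersen-diameter≤2; petersen-cubic)
open Twins petersen (# 0)

twinnedPetersen-maxDegree : ∀ t → HasMaxDegree (withTwins t) (t + 3)
-- Vertex 7 is the pair {2,3}, disjoint from the pair {0,1} at the twinned vertex 0.
twinnedPetersen-maxDegree = withTwins-maxDegree {v = # 7}
  (λ u → ℕ.≤-reflexive (petersen-cubic u)) (from-yes (# 7 ⟷? # 0)) (petersen-cubic (# 7))

twinnedPetersen-size : ∀ t → size (withTwins t) ≡ t * 3 + 15
twinnedPetersen-size t = trans (withTwins-size t) (cong (λ d → t * d + 15) (petersen-cubic (# 0)))

twinnedPetersen-diameter≤2 : ∀ t → DiameterAtMost2 (withTwins t)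
twinnedPetersen-diameter≤2 = withTwins-diameter≤2 petersen-diameter≤2

bound-< : ∀ s {m τ} → m ≡ (1 + s) * 3 + 15 → 1 + s + 10 ≤ 1 + τ →
  (4 + s) * (3 + s) * (1 + s + 10) + 2 * m ℕ.< τ * (1 + (4 + s) ^ 2)
bound-< s {m} {τ} refl (s≤s s+10≤τ) = begin-strict
  -- With `1 + s` twins the slack is `2 * (1 + s)`, visibly positive.
  lhs                           <⟨ ℕ.m<m+n lhs {2 * (1 + s)} (s≤s z≤n) ⟩
  lhs + 2 * (1 + s)             ≡⟨ identity s ⟩
  (s + 10) * (1 + (4 + s) ^ 2)  ≤⟨ ℕ.*-monoˡ-≤ (1 + (4 + s) ^ 2) s+10≤τ ⟩
  τ * (1 + (4 + s) ^ 2)         ∎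
  where
  open ℕ.≤-Reasoning
  lhs = (4 + s) * (3 + s) * (1 + s + 10) + 2 * ((1 + s) * 3 + 15)
  identity : ∀ s →
    (4 + s) * (3 + s) * (1 + s + 10) + 2 * ((1 + s) * 3 + 15) + 2 * (1 + s) ≡
    -- The square appears as `_^_` unfolds it, leaving only sums and products.
    (s + 10) * (1 + (4 + s) * ((4 + s) * 1))
  identity = solve-∀

corollary3p2 : ∀ (Δ : ℕ) → 4 ≤ Δ →
    ∃[ G ] Connected G × HasMaxDegree G Δ ×
    (+ τD G / 1) > (+ (Δ * (Δ ∸ 1) * Graph.order G + 2 * size G) / (1 + Δ ^ 2))
corollary3p2 Δ@(suc (suc (suc t@(suc s)))) (s≤s (s≤s (s≤s (s≤s z≤n)))) =
  -- Here `Δ` is `4 + s` and `t` is `1 + s`, so `Δ ∸ 1` reduces to the factor `3 + s` of `bound-<`.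
  withTwins t ,
  (zero , diameter≤2⇒walk (withTwins t) (twinnedPetersen-diameter≤2 t)) ,
  subst (HasMaxDegree (withTwins t)) (ℕ.+-comm t 3) (twinnedPetersen-maxDegree t) ,
  /<-from-*< _ (τD (withTwins t)) (Δ ^ 2)
    (bound-< s (twinnedPetersen-size t)
      (order≤1+minIVCSize (withTwins t) (twinnedPetersen-diameter≤2 t) (τD-isMin (withTwins t))))
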